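{- Let $m,n,c$ be positive integers such that $mnc\equiv 0$ or $3\pmod 4$, and suppose $m,n\geqslant 7$ are both odd. Then there exists an integer Heffter array set $\mathrm{IHS}(m,n;c)$.
   Context: An integer Heffter array set $\mathrm{IHS}(m,n;c)$ is a collection of $c$ completely filled $m\times n$ arrays with integer entries such that the absolute values of all $mnc$ entries (taken over all $c$ arrays) are exactly $1,2,\ldots,mnc$, each occurring exactly once, and in every array the entries of each row and of each column sum to $0$. -}

module Defs where

open import Data.Fin using (Fin)
open import Data.Integer using (ℤ; 0ℤ; ∣_∣)
open import Data.Integer.Properties using (+-0-commutativeMonoid)
open import Data.Nat using (ℕ; _*_; _≤_; _%_)
open import Data.Product using (_×_; _,_; ∃!)
open import Data.Vec.Functional using (Vector)
open import Relation.Binary.PropositionalEquality using (_≡_)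
open import Algebra.Properties.CommutativeMonoid.Sum +-0-commutativeMonoid using (sum)

Odd : ℕ → Set
Odd n = n % 2 ≡ 1

-- An m × n array as the vector of its m rows.
Array : ℕ → ℕ → Set
Array m n = Vector (Vector ℤ n) m

record IsIHS (m n c : ℕ) (A : Vector (Array m n) c) : Set where
  field
    -- Together the first two fields say that (k , i , j) ↦ ∣ A k i j ∣ is a
    -- bijection from the cells of all c arrays onto {1, …, mnc}.
    inRange     : ∀ k i j → 1 ≤ ∣ A k i j ∣ × ∣ A k i j ∣ ≤ m * n * c
    exactlyOnce : ∀ v → 1 ≤ v → v ≤ m * n * c →
                  ∃! {A = Fin c × Fin m × Fin n} _≡_ λ (k , i , j) → ∣ A k i j ∣ ≡ v
    rowSum      : ∀ k i → sum (λ j → A k i j) ≡ 0ℤ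
    columnSum   : ∀ k j → sum (λ i → A k i j) ≡ 0ℤ

{-# OPTIONS --safe #-}

-- Write x = 2t + 1, y = C - t, z = C + 1 + t, so that x + y = z.  For t running
-- over 4, 6, 7 or 9 consecutive values these triples, signed and permuted
-- within columns, form a 3 × 4, 3 × 6, 3 × 7 or 3 × 9 block with zero line
-- sums.  Such blocks fill the top three rows and the left three columns of
-- every array, using up W = m + n - 3 consecutive values of t per array.
--
-- The remaining (m - 3) × (n - 3) part has even sides and is cut into blocks
-- with sides 4 and 6, filled with quadruples b, b + 2, b + 4, b + 6.  Each
-- quadruple occupies two rows and two columns with opposite signs in each of
-- them, so its base b is arbitrary.  Of the numbers 1, …, mnc the x take the
-- first Wc odd ones.  The quadruples take the even numbers in between and, two
-- at a time, intervals of length 8; then come the y and the z.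
--
-- Two parity problems are solved in the corner block: nine separate quadruples
-- never fill a 6 × 6 block, but six of them together with a progression of 12
-- terms and step 2 do; and if the numbers left for the intervals are 4 modulo
-- 8, then one array takes an interval of length 12 in its corner.
--
-- There are as many cells as values, so it suffices to hit every value.

module Submission where

open import Defs
open import Data.Bool using (Bool; true; false)
open import Data.Bool.Properties using (T-≡)
open import Data.Fin as Fin using (Fin; zero; suc; toℕ; fromℕ<; combine; punchOut; _↑ˡ_; _↑ʳ_; splitAt)
import Data.Fin.Properties as Fin
open import Data.Integer as ℤ using (ℤ; +_; -_; 0ℤ; ∣_∣; sign; _◃_)
import Data.Integer.Properties as ℤ
open import Data.Nat
open import Data.Nat.DivMod
open import Data.Nat.Properties
open import Data.Nat.Tactic.RingSolver using (solve-∀)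
open import Data.Product using (_×_; _,_; ∃; ∃₂; proj₁; proj₂)
import Data.Sign as Sign
open import Data.Sum as Sum using (_⊎_; inj₁; inj₂)
open import Data.Vec using (Vec; []; _∷_; lookup)
open import Data.Vec.Functional using (Vector; _++_)
open import Data.Vec.Functional.Properties using (lookup-++ˡ; lookup-++ʳ)
open import Function using (_∘_)
open import Function.Bundles using (Equivalence)
open import Function.Definitions using (Injective)
open import Relation.Binary.PropositionalEquality
open import Relation.Nullary using (Dec; yes; no; contradiction)
open import Relation.Nullary.Decidable using (True; toWitness; _×-dec_)
open import Algebra.Properties.CommutativeMonoid.Sum ℤ.+-0-commutativeMonoid using (sum; sum-cong-≗; ∑-comm; sum-replicate-zero)
open import Algebra.Properties.CommutativeMonoid.Sum +-0-commutativeMonoid using () renaming (sum to sumℕ; sum-replicate-zero to sumℕ-zero)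
open import Algebra.Properties.Semiring.Sum ℤ.+-*-semiring using (*-distribʳ-sum)

private
  variable
    m n n′ p q c w : ℕ
    S S′ : ℕ → Set

-- Arrays with zero line sums and their juxtaposition.

-- S describes values that are certain to occur; more may occur, and twice.
record Filled (m n : ℕ) (S : ℕ → Set) : Set where
  field
    entry    : Array m n
    row-zero : ∀ i → sum (entry i) ≡ 0ℤ
    col-zero : ∀ j → sum (λ i → entry i j) ≡ 0ℤ
    hits     : ∀ {v} → S v → ∃₂ λ i j → ∣ entry i j ∣ ≡ v

open Filled

weaken : (∀ {v} → S′ v → S v) → Filled m n S → Filled m n S′
weaken f A = record
  { entry = entry A ; row-zero = row-zero A ; col-zero = col-zero A ; hits = λ s → hits A (f s) }

transpose : Filled m n S → Filled n m S
transpose A = record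
  { entry = λ i j → entry A j i
  ; row-zero = col-zero A
  ; col-zero = row-zero A
  ; hits = λ s → let i , j , eq = hits A s in j , i , eq
  }

sum-++ : (xs : Vector ℤ m) (ys : Vector ℤ n) → sum (xs ++ ys) ≡ sum xs ℤ.+ sum ys
sum-++ {zero}  xs ys = sym (ℤ.+-identityˡ _)
sum-++ {suc m} {n} xs ys = begin
  xs zero ℤ.+ sum (λ i → (xs ++ ys) (suc i))        ≡⟨ cong (ℤ._+_ (xs zero)) (sum-cong-≗ tail-++) ⟩
  xs zero ℤ.+ sum ((λ i → xs (suc i)) ++ ys)        ≡⟨ cong (ℤ._+_ (xs zero)) (sum-++ (λ i → xs (suc i)) ys) ⟩
  xs zero ℤ.+ (sum (λ i → xs (suc i)) ℤ.+ sum ys)   ≡⟨ ℤ.+-assoc (xs zero) _ _ ⟨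
  xs zero ℤ.+ sum (λ i → xs (suc i)) ℤ.+ sum ys     ∎
  where
  open ≡-Reasoning
  tail-++ : ∀ i → (xs ++ ys) (suc i) ≡ ((λ i → xs (suc i)) ++ ys) i
  tail-++ i with splitAt m i
  ... | inj₁ _ = refl
  ... | inj₂ _ = refl

beside : Filled m n S → Filled m n′ S′ → Filled m (n + n′) (λ v → S v ⊎ S′ v)
beside {m} {n} {S} {n′} {S′} A B = record
  { entry = λ i → entry A i ++ entry B i
  ; row-zero = λ i → trans (sum-++ (entry A i) (entry B i)) (cong₂ ℤ._+_ (row-zero A i) (row-zero B i))
  ; col-zero = col
  ; hits = hit
  }
  where
  col : ∀ j → sum (λ i → (entry A i ++ entry B i) j) ≡ 0ℤ
  col j with splitAt n j
  ... | inj₁ a = col-zero A a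
  ... | inj₂ b = col-zero B b
  hit : ∀ {v} → S v ⊎ S′ v → ∃₂ λ i j → ∣ (entry A i ++ entry B i) j ∣ ≡ v
  hit (inj₁ s) = let i , j , eq = hits A s in
    i , j ↑ˡ n′ , trans (cong ∣_∣ (lookup-++ˡ (entry A i) (entry B i) j)) eq
  hit (inj₂ s) = let i , j , eq = hits B s in
    i , n ↑ʳ j , trans (cong ∣_∣ (lookup-++ʳ (entry A i) (entry B i) j)) eq

above : Filled m n S → Filled p n S′ → Filled (m + p) n (λ v → S v ⊎ S′ v)
above A B = transpose (beside (transpose A) (transpose B))

Series : ℕ → (ℕ → Set) → (ℕ → ℕ → Set) → ℕ → Set
Series b S Q v = S v ⊎ ∃ λ k → k < b × Q k v

-- New blocks go on the left because `suc b * 4 + n` reduces to `4 + (b * 4 + n)`, so the width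
-- needs no transport.
widen : {Q : ℕ → ℕ → Set} → ∀ b → Filled m n S → (∀ k → k < b → Filled m 4 (Q k)) →
        Filled m (b * 4 + n) (Series b S Q)
widen zero    A B = weaken (λ { (inj₁ s) → s }) A
widen {S = S} {Q = Q} (suc b) A B =
  weaken split (beside (B b (n<1+n b)) (widen b A (λ k k<b → B k (m<n⇒m<1+n k<b))))
  where
  split : ∀ {v} → Series (suc b) S Q v → Q b v ⊎ Series b S Q v
  split (inj₁ s) = inj₂ (inj₁ s)
  split (inj₂ (k , k<1+b , q)) with m≤n⇒m<n∨m≡n (s≤s⁻¹ k<1+b)
  ... | inj₁ k<b  = inj₂ (inj₂ (k , k<b , q))
  ... | inj₂ refl = inj₁ q

-- Tables of signed linear forms.

-- A cell of a table is a sign and a code ≥ 1.  Code 1 + l + g * L stands for the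
-- linear form with coefficients term g l in some parameters ρ.
Table : ℕ → ℕ → Set
Table m n = Vec (Vec ℤ n) m

code : Table m n → Fin m → Fin n → ℤ
code T i j = lookup (lookup T i) j

module Linear {K : ℕ} (L : ℕ) .{{_ : NonZero L}} (term : ℕ → ℕ → Vector ℕ K) where

  coefficients : ℤ → Vector ℕ K
  coefficients c = term ((∣ c ∣ ∸ 1) / L) ((∣ c ∣ ∸ 1) % L)

  signed : ℤ → Vector ℤ K
  signed c k = sign c ◃ coefficients c k

  evaluate : Vector ℕ K → Vector ℕ K → ℕ
  evaluate ρ a = sumℕ (λ k → a k * ρ k)

  -- Zero sums are required coefficient by coefficient. This is a finite check, yet it gives zero
  -- sums for all values of the parameters at once.
  Valid : ℕ → Table m n → Set
  Valid {m} {n} G T =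
    (∀ i k → sum (λ j → signed (code T i j) k) ≡ 0ℤ) ×
    (∀ j k → sum (λ i → signed (code T i j) k) ≡ 0ℤ) ×
    (∀ (g : Fin G) (l : Fin L) → ∃₂ λ i j →
      (∣ code T i j ∣ ∸ 1) / L ≡ toℕ g × (∣ code T i j ∣ ∸ 1) % L ≡ toℕ l)

  valid? : ∀ G (T : Table m n) → Dec (Valid G T)
  valid? G T =
    Fin.all? (λ i → Fin.all? λ k → sum (λ j → signed (code T i j) k) ℤ.≟ 0ℤ) ×-dec
    Fin.all? (λ j → Fin.all? λ k → sum (λ i → signed (code T i j) k) ℤ.≟ 0ℤ) ×-dec
    Fin.all? (λ g → Fin.all? λ l → Fin.any? λ i → Fin.any? λ j →
      ((∣ code T i j ∣ ∸ 1) / L ≟ toℕ g) ×-dec ((∣ code T i j ∣ ∸ 1) % L ≟ toℕ l))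

  ◃-sum : ∀ {N} s (a ρ : Vector ℕ N) →
          s ◃ sumℕ (λ k → a k * ρ k) ≡ sum (λ k → (s ◃ a k) ℤ.* + ρ k)
  ◃-sum {zero}  Sign.+ a ρ = refl
  ◃-sum {zero}  Sign.- a ρ = refl
  ◃-sum {suc N} s a ρ = begin
    s ◃ (a zero * ρ zero + rest)                 ≡⟨ ℤ.◃-distrib-+ s (a zero * ρ zero) rest ⟩
    (s ◃ a zero * ρ zero) ℤ.+ (s ◃ rest)         ≡⟨ cong₂ ℤ._+_ head (◃-sum s (λ k → a (suc k)) (λ k → ρ (suc k))) ⟩
    (s ◃ a zero) ℤ.* + ρ zero ℤ.+ sum (λ k → (s ◃ a (suc k)) ℤ.* + ρ (suc k)) ∎
    where
    open ≡-Reasoning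
    rest = sumℕ (λ k → a (suc k) * ρ (suc k))
    head : s ◃ a zero * ρ zero ≡ (s ◃ a zero) ℤ.* + ρ zero
    head = begin
      s ◃ a zero * ρ zero                       ≡⟨ cong (_◃ (a zero * ρ zero)) (s*+ s) ⟨
      (s Sign.* Sign.+) ◃ a zero * ρ zero       ≡⟨ ℤ.◃-distrib-* s Sign.+ (a zero) (ρ zero) ⟩
      (s ◃ a zero) ℤ.* (Sign.+ ◃ ρ zero)        ≡⟨ cong ((s ◃ a zero) ℤ.*_) (ℤ.+◃n≡+n (ρ zero)) ⟩
      (s ◃ a zero) ℤ.* + ρ zero                 ∎
      where
      s*+ : ∀ s → s Sign.* Sign.+ ≡ s
      s*+ Sign.+ = refl
      s*+ Sign.- = refl

  -- Interchanging the two summations turns the line sum into a combination of the parameters whose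
  -- weights are the coefficient sums, all zero.
  line-zero : ∀ {N} (ρ : Vector ℕ K) (c : Vector ℤ N) → (∀ k → sum (λ j → signed (c j) k) ≡ 0ℤ) →
              sum (λ j → sign (c j) ◃ evaluate ρ (coefficients (c j))) ≡ 0ℤ
  line-zero {N} ρ c balanced = begin
    sum (λ j → sign (c j) ◃ evaluate ρ (coefficients (c j)))   ≡⟨ sum-cong-≗ (λ j → ◃-sum (sign (c j)) (coefficients (c j)) ρ) ⟩
    sum (λ j → sum (λ k → signed (c j) k ℤ.* + ρ k))           ≡⟨ ∑-comm (λ j k → signed (c j) k ℤ.* + ρ k) ⟩
    sum (λ k → sum (λ j → signed (c j) k ℤ.* + ρ k))           ≡⟨ sum-cong-≗ (λ k → sym (*-distribʳ-sum (+ ρ k) (λ j → signed (c j) k))) ⟩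
    sum (λ k → sum (λ j → signed (c j) k) ℤ.* + ρ k)           ≡⟨ sum-cong-≗ (λ k → cong (ℤ._* + ρ k) (balanced k)) ⟩
    sum (λ (_ : Fin K) → 0ℤ)                                   ≡⟨ sum-replicate-zero K ⟩
    0ℤ                                                         ∎
    where open ≡-Reasoning

  fill : ∀ G (T : Table m n) → True (valid? G T) → (ρ : Vector ℕ K) →
         Filled m n (λ v → ∃₂ λ g l → g < G × l < L × v ≡ evaluate ρ (term g l))
  fill G T valid ρ = record
    { entry = λ i j → sign (code T i j) ◃ evaluate ρ (coefficients (code T i j))
    ; row-zero = λ i → line-zero ρ (code T i) (rows i)
    ; col-zero = λ j → line-zero ρ (λ i → code T i j) (cols j)
    ; hits = λ { (g , l , g<G , l<L , refl) →
        let i , j , eg , el = cells (fromℕ< g<G) (fromℕ< l<L) in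
        i , j , trans (ℤ.abs-◃ (sign (code T i j)) _)
          (cong₂ (λ g l → evaluate ρ (term g l)) (trans eg (Fin.toℕ-fromℕ< g<G)) (trans el (Fin.toℕ-fromℕ< l<L))) }
    }
    where
    checked = toWitness valid
    rows = proj₁ checked
    cols = proj₁ (proj₂ checked)
    cells = proj₂ (proj₂ checked)

-- Blocks with three rows, filled with triples.

record Over (P : ℕ → ℕ → Set) (a w v : ℕ) : Set where
  constructor at
  field
    offset   : ℕ
    offset<w : offset < w
    holds    : P (a + offset) v

-- The clauses are x, y and z in this order; the one for y is additive to avoid truncated
-- subtraction.
Triple : ℕ → ℕ → ℕ → Set
Triple C t v = v ≡ 1 + 2 * t ⊎ v + t ≡ C ⊎ v ≡ suc C + t

-- Parameters t, y of the last triple, and 1; g = 0, 1, 2 gives x, y, z.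
stripTerm : ℕ → ℕ → ℕ → Vector ℕ 3
stripTerm w 0 i zero             = 2
stripTerm w 0 i (suc zero)       = 0
stripTerm w 0 i (suc (suc zero)) = 1 + 2 * i
stripTerm w 1 i zero             = 0
stripTerm w 1 i (suc zero)       = 1
stripTerm w 1 i (suc (suc zero)) = w ∸ suc i
stripTerm w _ i zero             = 2
stripTerm w _ i (suc zero)       = 1
stripTerm w _ i (suc (suc zero)) = w + i

fillStrip : .{{_ : NonZero w}} (T : Table 3 w) → True (Linear.valid? w (stripTerm w) 3 T) →
            ∀ C t → t + w ≤ C → Filled 3 w (Over (Triple C) t w)
fillStrip {w} T valid C t t+w≤C = weaken cell (Linear.fill w (stripTerm w) 3 T valid ρ)
  where
  -- The last y replaces `C` as a parameter: `C - t` would have a negative coefficient, and the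
  -- forms only have natural ones. By `t+w≤C` the subtraction is exact.
  Y = suc C ∸ (t + w)
  Y-eq : t + w + Y ≡ suc C
  Y-eq = m+[n∸m]≡n (m≤n⇒m≤1+n t+w≤C)
  ρ : Vector ℕ 3
  ρ zero             = t
  ρ (suc zero)       = Y
  ρ (suc (suc zero)) = 1
  x-value : ∀ t Y i → 1 + 2 * (t + i) ≡ 2 * t + (0 * Y + ((1 + 2 * i) * 1 + 0))
  x-value = solve-∀
  y-value : ∀ t Y i k → suc (0 * t + (1 * Y + (k * 1 + 0)) + (t + i)) ≡ t + (suc i + k) + Y
  y-value = solve-∀
  z-value : ∀ t Y w i → t + w + Y + (t + i) ≡ 2 * t + (1 * Y + ((w + i) * 1 + 0))
  z-value = solve-∀
  cell : ∀ {v} → Over (Triple C) t w v →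
         ∃₂ λ g l → g < 3 × l < w × v ≡ Linear.evaluate w (stripTerm w) ρ (stripTerm w g l)
  cell (at i i<w (inj₁ refl)) = 0 , i , s≤s z≤n , i<w , x-value t Y i
  cell {v} (at i i<w (inj₂ (inj₁ v+t≡C))) = 1 , i , s≤s (s≤s z≤n) , i<w ,
    +-cancelʳ-≡ (t + i) _ _ (suc-injective (begin
      suc (v + (t + i))                                       ≡⟨ cong suc v+t≡C ⟩
      suc C                                                   ≡⟨ Y-eq ⟨
      t + w + Y                                               ≡⟨ cong (λ u → t + u + Y) (m+[n∸m]≡n i<w) ⟨
      t + (suc i + (w ∸ suc i)) + Y                           ≡⟨ y-value t Y i (w ∸ suc i) ⟨
      suc (0 * t + (1 * Y + ((w ∸ suc i) * 1 + 0)) + (t + i)) ∎))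
    where open ≡-Reasoning
  cell (at i i<w (inj₂ (inj₂ refl))) = 2 , i , s≤s (s≤s (s≤s z≤n)) , i<w ,
    trans (cong (_+ (t + i)) (sym Y-eq)) (z-value t Y w i)

-- Codes 1 to 4 are the x, 5 to 8 the y, 9 to 12 the z. Each column is one triple up to sign, so
-- only the row sums constrain the arrangement. The wider tables follow the same scheme.
stripTable4 : Table 3 4
stripTable4 =
  (+ 1 ∷ - + 2 ∷ - + 3 ∷ + 4 ∷ []) ∷
  (+ 5 ∷ + 10 ∷ - + 7 ∷ - + 12 ∷ []) ∷
  (- + 9 ∷ - + 6 ∷ + 11 ∷ + 8 ∷ []) ∷ []

strip4 : ∀ C t → t + 4 ≤ C → Filled 3 4 (Over (Triple C) t 4)
strip4 = fillStrip stripTable4 _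

stripTable6 : Table 3 6
stripTable6 =
  (+ 1 ∷ - + 2 ∷ - + 15 ∷ - + 10 ∷ + 11 ∷ + 18 ∷ []) ∷
  (+ 7 ∷ + 14 ∷ + 3 ∷ - + 4 ∷ - + 17 ∷ - + 12 ∷ []) ∷
  (- + 13 ∷ - + 8 ∷ + 9 ∷ + 16 ∷ + 5 ∷ - + 6 ∷ []) ∷ []

strip6 : ∀ C t → t + 6 ≤ C → Filled 3 6 (Over (Triple C) t 6)
strip6 = fillStrip stripTable6 _

stripTable7 : Table 3 7
stripTable7 =
  (+ 1 ∷ - + 2 ∷ - + 3 ∷ + 18 ∷ - + 12 ∷ - + 13 ∷ + 14 ∷ []) ∷
  (+ 8 ∷ + 16 ∷ - + 10 ∷ - + 11 ∷ - + 5 ∷ - + 6 ∷ + 7 ∷ []) ∷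
  (- + 15 ∷ - + 9 ∷ + 17 ∷ - + 4 ∷ + 19 ∷ + 20 ∷ - + 21 ∷ []) ∷ []

strip7 : ∀ C t → t + 7 ≤ C → Filled 3 7 (Over (Triple C) t 7)
strip7 = fillStrip stripTable7 _

stripTable9 : Table 3 9
stripTable9 =
  (+ 1 ∷ - + 20 ∷ + 12 ∷ + 13 ∷ + 5 ∷ - + 24 ∷ - + 7 ∷ + 26 ∷ - + 18 ∷ []) ∷
  (+ 10 ∷ + 2 ∷ - + 21 ∷ - + 22 ∷ + 14 ∷ + 6 ∷ + 25 ∷ - + 17 ∷ - + 9 ∷ []) ∷
  (- + 19 ∷ + 11 ∷ + 3 ∷ + 4 ∷ - + 23 ∷ + 15 ∷ - + 16 ∷ - + 8 ∷ + 27 ∷ []) ∷ []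

strip9 : ∀ C t → t + 9 ≤ C → Filled 3 9 (Over (Triple C) t 9)
strip9 = fillStrip stripTable9 _

-- Blocks filled with quadruples and progressions.

Progression : ℕ → ℕ → ℕ → ℕ → Set
Progression D s ℓ v = ∃ λ i → i < ℓ × v ≡ D + i * s

Quad : (ℕ → ℕ) → ℕ → ℕ → Set
Quad b j = Progression (b j) 2 4

unit : ℕ → Vector ℕ n
unit zero    zero    = 1
unit zero    (suc x) = 0
unit (suc g) zero    = 0
unit (suc g) (suc x) = unit g x

sum-unit : ∀ {g} (f : ℕ → ℕ) → g < n → sumℕ {n} (λ x → unit g x * f (toℕ x)) ≡ f g
sum-unit {suc n} {zero}  f _ = begin
  f 0 + 0 + sumℕ {n} (λ _ → 0)   ≡⟨ cong₂ _+_ (+-identityʳ (f 0)) (sumℕ-zero n) ⟩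
  f 0 + 0                        ≡⟨ +-identityʳ (f 0) ⟩
  f 0                            ∎
  where open ≡-Reasoning
sum-unit {suc n} {suc g} f (s≤s g<n) = sum-unit (λ x → f (suc x)) g<n

-- Parameters 1, D and the bases.  The first d groups of four codes make up one
-- progression from D with step s, each of the others is a quadruple.
innerTerm : (d s h : ℕ) → ℕ → ℕ → Vector ℕ (2 + h)
innerTerm d s h g l = pick (g <ᵇ d)
  where
  pick : Bool → Vector ℕ (2 + h)
  pick true  zero          = (l + g * 4) * s
  pick true  (suc zero)    = 1
  pick true  (suc (suc _)) = 0
  pick false zero          = l * 2
  pick false (suc zero)    = 0
  pick false (suc (suc x)) = unit (g ∸ d) x

Inner : (d s h D : ℕ) (b : ℕ → ℕ) → ℕ → ℕ → Set
Inner d s h D b j v = Progression D s (d * 4) v ⊎ Over (Quad b) j h v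

fillInner : ∀ d s h (T : Table m n) → True (Linear.valid? 4 (innerTerm d s h) (d + h) T) →
            ∀ D b j → Filled m n (Inner d s h D b j)
fillInner d s h T valid D b j = weaken cell (Linear.fill 4 (innerTerm d s h) (d + h) T valid ρ)
  where
  open ≡-Reasoning
  ρ : Vector ℕ (2 + h)
  ρ zero          = 1
  ρ (suc zero)    = D
  ρ (suc (suc x)) = b (j + toℕ x)
  value : ℕ → ℕ → ℕ
  value g l = Linear.evaluate 4 (innerTerm d s h) ρ (innerTerm d s h g l)
  progression-value : ∀ g l → g < d → value g l ≡ D + (l + g * 4) * s
  -- `pick` branches on the Boolean `g <ᵇ d`, so rewriting that test to `true` selects the
  -- progression clauses.
  progression-value g l g<d rewrite Equivalence.to T-≡ (<⇒<ᵇ g<d) = begin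
    (l + g * 4) * s * 1 + (D + 0 + sumℕ {h} (λ _ → 0))
      ≡⟨ cong (λ z → (l + g * 4) * s * 1 + (D + 0 + z)) (sumℕ-zero h) ⟩
    (l + g * 4) * s * 1 + (D + 0 + 0)   ≡⟨ tidy D ((l + g * 4) * s) ⟩
    D + (l + g * 4) * s                 ∎
    where
    tidy : ∀ D x → x * 1 + (D + 0 + 0) ≡ D + x
    tidy = solve-∀
  d+g≮d : ∀ d g → (d + g <ᵇ d) ≡ false
  d+g≮d zero    g = refl
  d+g≮d (suc d) g = d+g≮d d g
  quad-value : ∀ g l → g < h → value (d + g) l ≡ b (j + g) + l * 2
  quad-value g l g<h rewrite d+g≮d d g | m+n∸m≡n d g = begin
    l * 2 * 1 + sumℕ {h} (λ x → unit g x * b (j + toℕ x))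
      ≡⟨ cong₂ _+_ (*-identityʳ (l * 2)) (sum-unit (λ x → b (j + x)) g<h) ⟩
    l * 2 + b (j + g)   ≡⟨ +-comm (l * 2) _ ⟩
    b (j + g) + l * 2   ∎
  cell : ∀ {v} → Inner d s h D b j v → ∃₂ λ g l → g < d + h × l < 4 × v ≡ value g l
  cell (inj₁ (i , i<4d , refl)) = i / 4 , i % 4 , ≤-trans g<d (m≤m+n d h) , m%n<n i 4 ,
    trans (cong (λ i → D + i * s) (m≡m%n+[m/n]*n i 4)) (sym (progression-value (i / 4) (i % 4) g<d))
    where
    g<d : i / 4 < d
    g<d = m<n*o⇒m/o<n i<4d
  cell (inj₂ (at g g<h (l , l<4 , refl))) = d + g , l , +-monoʳ-< d g<h , l<4 , sym (quad-value g l g<h)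

-- On a 2 × 2 square with alternating signs a quadruple leaves opposite sums in its two rows and in
-- its two columns: ±2 in one direction and ±4 in the other, whatever the base. Adjacent squares
-- cancel these; in each row of the 4 × 6 block two squares leaving 2 offset one leaving 4.
quadTable44 : Table 4 4
quadTable44 =
  (+ 1 ∷ - + 2 ∷ - + 5 ∷ + 6 ∷ []) ∷
  (- + 3 ∷ + 4 ∷ + 7 ∷ - + 8 ∷ []) ∷
  (- + 9 ∷ + 10 ∷ + 13 ∷ - + 14 ∷ []) ∷
  (+ 11 ∷ - + 12 ∷ - + 15 ∷ + 16 ∷ []) ∷ []

quads44 : ∀ D x j → Filled 4 4 (Inner 0 2 4 D x j)
quads44 = fillInner 0 2 4 quadTable44 _

quadTable46 : Table 4 6
quadTable46 =
  (+ 1 ∷ - + 2 ∷ + 5 ∷ - + 6 ∷ - + 9 ∷ + 11 ∷ []) ∷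
  (- + 3 ∷ + 4 ∷ - + 7 ∷ + 8 ∷ + 10 ∷ - + 12 ∷ []) ∷
  (- + 13 ∷ + 14 ∷ - + 17 ∷ + 18 ∷ + 21 ∷ - + 23 ∷ []) ∷
  (+ 15 ∷ - + 16 ∷ + 19 ∷ - + 20 ∷ - + 22 ∷ + 24 ∷ []) ∷ []

quads46 : ∀ D x j → Filled 4 6 (Inner 0 2 6 D x j)
quads46 = fillInner 0 2 6 quadTable46 _

-- Codes 1 to 12 are the terms of the interval, the others form quadruples. Since `D` is arbitrary,
-- every line has as many positive as negative terms of the interval.
intervalTable44 : Table 4 4
intervalTable44 =
  (+ 6 ∷ - + 7 ∷ - + 11 ∷ + 12 ∷ []) ∷
  (+ 3 ∷ - + 2 ∷ + 9 ∷ - + 10 ∷ []) ∷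
  (- + 4 ∷ + 8 ∷ - + 15 ∷ + 13 ∷ []) ∷
  (- + 5 ∷ + 1 ∷ + 16 ∷ - + 14 ∷ []) ∷ []

interval44 : ∀ D x j → Filled 4 4 (Inner 3 1 1 D x j)
interval44 = fillInner 3 1 1 intervalTable44 _

intervalTable46 : Table 4 6
intervalTable46 =
  (+ 9 ∷ + 2 ∷ + 13 ∷ - + 15 ∷ - + 1 ∷ - + 6 ∷ []) ∷
  (- + 5 ∷ + 11 ∷ + 18 ∷ - + 20 ∷ - + 24 ∷ + 23 ∷ []) ∷
  (- + 12 ∷ - + 3 ∷ - + 17 ∷ + 19 ∷ + 7 ∷ + 4 ∷ []) ∷
  (+ 8 ∷ - + 10 ∷ - + 14 ∷ + 16 ∷ + 21 ∷ - + 22 ∷ []) ∷ []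

interval46 : ∀ D x j → Filled 4 6 (Inner 3 1 3 D x j)
interval46 = fillInner 3 1 3 intervalTable46 _

intervalTable66 : Table 6 6
intervalTable66 =
  (+ 4 ∷ + 7 ∷ - + 2 ∷ - + 11 ∷ - + 13 ∷ + 14 ∷ []) ∷
  (- + 18 ∷ + 17 ∷ + 9 ∷ - + 5 ∷ - + 24 ∷ + 23 ∷ []) ∷
  (+ 19 ∷ - + 20 ∷ - + 6 ∷ + 10 ∷ + 21 ∷ - + 22 ∷ []) ∷
  (- + 8 ∷ - + 3 ∷ + 1 ∷ + 12 ∷ + 15 ∷ - + 16 ∷ []) ∷
  (+ 26 ∷ - + 27 ∷ + 30 ∷ - + 32 ∷ + 36 ∷ - + 33 ∷ []) ∷
  (- + 25 ∷ + 28 ∷ - + 31 ∷ + 29 ∷ - + 35 ∷ + 34 ∷ []) ∷ []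

interval66 : ∀ D x j → Filled 6 6 (Inner 3 1 6 D x j)
interval66 = fillInner 3 1 6 intervalTable66 _

progressionTable66 : Table 6 6
progressionTable66 =
  (- + 15 ∷ + 13 ∷ - + 20 ∷ + 17 ∷ + 6 ∷ - + 1 ∷ []) ∷
  (- + 23 ∷ + 21 ∷ + 28 ∷ - + 25 ∷ - + 3 ∷ + 2 ∷ []) ∷
  (+ 16 ∷ - + 14 ∷ + 18 ∷ - + 19 ∷ - + 32 ∷ + 31 ∷ []) ∷
  (+ 33 ∷ - + 34 ∷ - + 27 ∷ + 26 ∷ - + 5 ∷ + 7 ∷ []) ∷
  (- + 35 ∷ + 36 ∷ - + 11 ∷ + 9 ∷ + 30 ∷ - + 29 ∷ []) ∷
  (+ 24 ∷ - + 22 ∷ + 12 ∷ - + 8 ∷ + 4 ∷ - + 10 ∷ []) ∷ []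

progression66 : ∀ D x j → Filled 6 6 (Inner 3 2 6 D x j)
progression66 = fillInner 3 2 6 progressionTable66 _

-- Assembling one array from blocks.

digits : ∀ c w {x} → x < c * w → ∃₂ λ k i → k < c × i < w × x ≡ i + k * w
digits c zero {x} x<c*0 = contradiction (subst (x <_) (*-zeroʳ c) x<c*0) λ ()
digits c w@(suc _) {x} x<c*w = x / w , x % w , m<n*o⇒m/o<n x<c*w , m%n<n x w , m≡m%n+[m/n]*n x w

split< : ∀ u {w i} → i < u + w → i < u ⊎ ∃ λ i′ → i′ < w × i ≡ u + i′
split< u {w} {i} i<u+w with i <? u
... | yes i<u = inj₁ i<u
... | no  i≮u = inj₂ (i ∸ u , +-cancelˡ-< u _ _ (subst (_< u + w) i≡ i<u+w) , i≡)
  where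
  i≡ : i ≡ u + (i ∸ u)
  i≡ = sym (m+[n∸m]≡n (≮⇒≥ i≮u))

over-split : ∀ {P : ℕ → ℕ → Set} t u {w v} → Over P t (u + w) v → Over P t u v ⊎ Over P (t + u) w v
over-split {P} t u {w} {v} (at i i<u+w pv) with split< u i<u+w
... | inj₁ i<u = inj₁ (at i i<u pv)
... | inj₂ (i′ , i′<w , refl) = inj₂ (at i′ i′<w (subst (λ x → P x v) (sym (+-assoc t u i′)) pv))

over-blocks : ∀ {P : ℕ → ℕ → Set} t c w {v} → Over P t (c * w) v → ∃ λ k → k < c × Over P (t + k * w) w v
over-blocks {P} t c w {v} (at x x<c*w pv) with digits c w x<c*w
... | k , i , k<c , i<w , refl = k , k<c , at i i<w (subst (λ x → P x v) (regroup t i (k * w)) pv)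
  where
  regroup : ∀ t i y → t + (i + y) ≡ t + y + i
  regroup = solve-∀

over-series : ∀ {P : ℕ → ℕ → Set} t u b w {v} → Over P t (u + b * w) v →
              Series b (Over P t u) (λ k → Over P (t + u + k * w) w) v
over-series t u b w = Sum.map₂ (over-blocks (t + u) b w) ∘ over-split t u

-- Every even number from 4 on is one of these plus a multiple of 4, so a corner with such sides can
-- be extended by blocks of width 4 to the whole inner part.
data Size : ℕ → Set where
  four : Size 4
  six  : Size 6

module _ (C : ℕ) where

  strip : (∀ t → t + w ≤ C → Filled 3 w (Over (Triple C) t w)) →
          ∀ b t → t + (w + b * 4) ≤ C → Filled 3 (b * 4 + w) (Over (Triple C) t (w + b * 4))
  strip {w} base b t t+w≤C =
    weaken (over-series t w b 4)
      (widen b (base t (≤-trans (+-monoʳ-≤ t (m≤m+n w (b * 4))) t+w≤C)) (λ k k<b → strip4 C (t + w + k * 4) (bound k<b)))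
    where
    bound : ∀ {k} → k < b → t + w + k * 4 + 4 ≤ C
    bound {k} k<b = begin
      t + w + k * 4 + 4       ≡⟨ regroup t w (k * 4) ⟩
      t + (w + (4 + k * 4))   ≤⟨ +-monoʳ-≤ t (+-monoʳ-≤ w (*-monoˡ-≤ 4 k<b)) ⟩
      t + (w + b * 4)         ≤⟨ t+w≤C ⟩
      C                       ∎
      where
      open ≤-Reasoning
      regroup : ∀ t w y → t + w + y + 4 ≡ t + (w + (4 + y))
      regroup = solve-∀

  evenBase : Size p → ∀ t → t + p ≤ C → Filled 3 p (Over (Triple C) t p)
  evenBase four = strip4 C
  evenBase six  = strip6 C

  oddBase : Size p → ∀ t → t + (3 + p) ≤ C → Filled 3 (3 + p) (Over (Triple C) t (3 + p))
  oddBase four = strip7 C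
  oddBase six  = strip9 C

module _ (x : ℕ → ℕ) where

  quadRow : Size p → ∀ j → Filled 4 p (Over (Quad x) j p)
  quadRow four j = weaken inj₂ (quads44 0 x j)
  quadRow six  j = weaken inj₂ (quads46 0 x j)

  -- A 4 × `p` block holds `p` quadruples. With `b` of them the corner grows to a band of `p` rows;
  -- each of the `a` further bands of four rows takes `q + b * 4` quadruples.
  inner : Size p → Size q → ∀ a b j → Filled p q S →
          Filled (a * 4 + p) (b * 4 + q) (λ v → S v ⊎ Over (Quad x) j (b * p + a * (q + b * 4)) v)
  inner {p} {q} {S} P Q a b j corner = weaken split
    (transpose (widen a (transpose firstRows) (λ k _ → transpose (fourRows (j + b * p + k * (q + b * 4))))))
    where
    firstRows : Filled p (b * 4 + q) (Series b S (λ k → Over (Quad x) (j + k * p) p))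
    firstRows = widen b corner (λ k _ → transpose (quadRow P (j + k * p)))
    fourRows : ∀ j → Filled 4 (b * 4 + q) (Over (Quad x) j (q + b * 4))
    fourRows j = weaken (over-series j q b 4) (widen b (quadRow Q j) (λ k _ → quadRow four (j + q + k * 4)))
    split : ∀ {v} → S v ⊎ Over (Quad x) j (b * p + a * (q + b * 4)) v →
            Series a (Series b S (λ k → Over (Quad x) (j + k * p) p))
                     (λ k → Over (Quad x) (j + b * p + k * (q + b * 4)) (q + b * 4)) v
    split (inj₁ s) = inj₁ (inj₁ s)
    split (inj₂ o) = Sum.map₁ (λ o → inj₂ (over-blocks j b p o)) (over-series j (b * p) a (q + b * 4) o)

-- The `d` groups of four form the progression. `quota` counts the quadruples, whose bases come from
-- a supply shared by all arrays.
record Corner (p q s d : ℕ) : Set where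
  field
    quota  : ℕ
    area   : (d + quota) * 4 ≡ p * q
    filled : ∀ D x j → Filled p q (Inner d s quota D x j)

-- Only the 6 × 6 corner needs a progression; its 12 terms count as three groups of four.
runQuads : Size p → Size q → ℕ
runQuads six six = 3
runQuads _   _   = 0

regular : (P : Size p) (Q : Size q) → Corner p q 2 (runQuads P Q)
regular four four = record { quota = 4 ; area = refl ; filled = quads44 }
regular four six  = record { quota = 6 ; area = refl ; filled = quads46 }
regular six  four = record { quota = 6 ; area = refl ; filled = λ D x j → transpose (quads46 D x j) }
regular six  six  = record { quota = 6 ; area = refl ; filled = progression66 }

special : Size p → Size q → Corner p q 1 3
special four four = record { quota = 1 ; area = refl ; filled = interval44 }
special four six  = record { quota = 3 ; area = refl ; filled = interval46 }
special six  four = record { quota = 3 ; area = refl ; filled = λ D x j → transpose (interval46 D x j) }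
special six  six  = record { quota = 6 ; area = refl ; filled = interval66 }

module Shape {p q} (P : Size p) (Q : Size q) (a b : ℕ) where

  m₀ n₀ width rest : ℕ
  m₀ = 3 + (a * 4 + p)
  n₀ = 3 + (b * 4 + q)
  width = 3 + q + b * 4 + (p + a * 4)
  rest = b * p + a * (q + b * 4)

  Cells : (C d s h D : ℕ) (x : ℕ → ℕ) (t j : ℕ) → ℕ → Set
  Cells C d s h D x t j v = Over (Triple C) t width v ⊎ Inner d s h D x j v

  module _ {s d} (K : Corner p q s d) where
    open Corner K

    array : ∀ C D x t j → t + width ≤ C → Filled m₀ n₀ (Cells C d s (quota + rest) D x t j)
    array C D x t j t+w≤C = weaken split (above top (beside left (inner x P Q a b (j + quota) (filled D x j))))
      where
      -- The top strip has one triple per column of the array, the left strip one per row below it.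
      w₁ = 3 + q + b * 4
      w₂ = p + a * 4
      top : Filled 3 n₀ (Over (Triple C) t w₁)
      top = subst (λ n → Filled 3 n (Over (Triple C) t w₁)) (columns b q)
        (strip C (oddBase C Q) b t (≤-trans (+-monoʳ-≤ t (m≤m+n w₁ w₂)) t+w≤C))
        where
        columns : ∀ b q → b * 4 + (3 + q) ≡ 3 + (b * 4 + q)
        columns = solve-∀
      left : Filled (a * 4 + p) 3 (Over (Triple C) (t + w₁) w₂)
      left = transpose (strip C (evenBase C P) a (t + w₁) (subst (_≤ C) (sym (+-assoc t w₁ w₂)) t+w≤C))
      split : ∀ {v} → Cells C d s (quota + rest) D x t j v →
              Over (Triple C) t w₁ v ⊎ Over (Triple C) (t + w₁) w₂ v ⊎
              Inner d s quota D x j v ⊎ Over (Quad x) (j + quota) rest v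
      split (inj₁ o) = Sum.map₂ inj₁ (over-split t w₁ o)
      split (inj₂ (inj₁ o)) = inj₂ (inj₂ (inj₁ (inj₁ o)))
      split (inj₂ (inj₂ o)) = inj₂ (inj₂ (Sum.map₁ inj₂ (over-split j quota o)))

-- Hitting every value implies hitting it once.

-- A missed `y` could be punched out, embedding `Fin (suc n)` into `Fin n`.
injective⇒surjective : ∀ {f : Fin n → Fin n} → Injective _≡_ _≡_ f → ∀ y → ∃ λ x → f x ≡ y
injective⇒surjective {suc n} {f} f-injective y with Fin.any? (λ x → f x Fin.≟ y)
... | yes preimage = preimage
... | no  ∄x = contradiction (Fin.injective⇒≤ avoid-injective) 1+n≰n
  where
  y≢f : ∀ x → y ≢ f x
  y≢f x eq = ∄x (x , sym eq)
  avoid-injective : Injective _≡_ _≡_ (λ x → punchOut (y≢f x))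
  avoid-injective eq = f-injective (Fin.punchOut-injective (y≢f _) (y≢f _) eq)

module _ (A : Vector (Array m n) c)
         (rows : ∀ k i → sum (λ j → A k i j) ≡ 0ℤ)
         (cols : ∀ k j → sum (λ i → A k i j) ≡ 0ℤ)
         (onto : ∀ v → 1 ≤ v → v ≤ m * n * c → ∃ λ k → ∃₂ λ i j → ∣ A k i j ∣ ≡ v) where

  private
    Cell = Fin c × Fin m × Fin n

    value : Cell → ℕ
    value (k , i , j) = ∣ A k i j ∣

    index : Cell → Fin (m * n * c)
    index (k , i , j) = combine (combine i j) k

    index-injective : ∀ {x y} → index x ≡ index y → x ≡ y
    index-injective {k , i , j} {k′ , i′ , j′} eq
      with ij≡ , refl ← Fin.combine-injective (combine i j) k (combine i′ j′) k′ eq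
      with refl , refl ← Fin.combine-injective i j i′ j′ ij≡ = refl

    cell : Fin (m * n * c) → Cell
    cell x = let k , i , j , _ = onto (suc (toℕ x)) (s≤s z≤n) (Fin.toℕ<n x) in k , i , j

    value-cell : ∀ x → value (cell x) ≡ suc (toℕ x)
    value-cell x = let _ , _ , _ , eq = onto (suc (toℕ x)) (s≤s z≤n) (Fin.toℕ<n x) in eq

    cell-injective : ∀ {x y} → cell x ≡ cell y → x ≡ y
    cell-injective {x} {y} eq = Fin.toℕ-injective (suc-injective
      (trans (sym (value-cell x)) (trans (cong value eq) (value-cell y))))

    -- `cell` is a right inverse of `value`, hence injective; followed by `index` it is an injective
    -- self-map of a finite set. So every cell is a chosen one, which yields both the range and the
    -- injectivity of `value`.
    cell-surjective : ∀ z → ∃ λ x → cell x ≡ z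
    cell-surjective z =
      let x , eq = injective⇒surjective (cell-injective ∘ index-injective) (index z) in x , index-injective eq

    value-range : ∀ z → 1 ≤ value z × value z ≤ m * n * c
    value-range z with x , refl ← cell-surjective z =
      subst (1 ≤_) (sym (value-cell x)) (s≤s z≤n) , subst (_≤ m * n * c) (sym (value-cell x)) (Fin.toℕ<n x)

    value-injective : ∀ {y z} → value y ≡ value z → y ≡ z
    value-injective {y} {z} eq with x , refl ← cell-surjective y | x′ , refl ← cell-surjective z =
      cong cell (Fin.toℕ-injective (suc-injective (trans (sym (value-cell x)) (trans eq (value-cell x′)))))

  onto⇒isIHS : IsIHS m n c A
  onto⇒isIHS = record
    { inRange = λ k i j → value-range (k , i , j)
    ; exactlyOnce = λ v 1≤v v≤N → let k , i , j , eq = onto v 1≤v v≤N in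
        (k , i , j) , eq , λ eq′ → value-injective (trans eq (sym eq′))
    ; rowSum = rows
    ; columnSum = cols
    }

assembleIHS : ∀ {σ} {S S′ : ℕ → ℕ → Set} →
              (∀ k → k < σ → Filled m n (S k)) → (∀ k → k < c → Filled m n (S′ k)) →
              (∀ {u} → u < m * n * (σ + c) →
                (∃ λ k → k < σ × S k (suc u)) ⊎ (∃ λ k → k < c × S′ k (suc u))) →
              ∃ λ (A : Vector (Array m n) (σ + c)) → IsIHS m n (σ + c) A
assembleIHS {m} {n} {c} {σ} {S} {S′} special regular everywhere = A , onto⇒isIHS A rows cols onto
  where
  B : (k : Fin σ) → Filled m n (S (toℕ k))
  B k = special (toℕ k) (Fin.toℕ<n k)
  B′ : (k : Fin c) → Filled m n (S′ (toℕ k))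
  B′ k = regular (toℕ k) (Fin.toℕ<n k)
  A : Vector (Array m n) (σ + c)
  A = (λ k → entry (B k)) ++ (λ k → entry (B′ k))
  rows : ∀ k i → sum (λ j → A k i j) ≡ 0ℤ
  rows k i with splitAt σ k
  ... | inj₁ k = row-zero (B k) i
  ... | inj₂ k = row-zero (B′ k) i
  cols : ∀ k j → sum (λ i → A k i j) ≡ 0ℤ
  cols k j with splitAt σ k
  ... | inj₁ k = col-zero (B k) j
  ... | inj₂ k = col-zero (B′ k) j
  locate : ∀ {v} → (∃ λ k → k < σ × S k v) ⊎ (∃ λ k → k < c × S′ k v) →
           ∃ λ k → ∃₂ λ i j → ∣ A k i j ∣ ≡ v
  locate {v} (inj₁ (k , k<σ , s)) =
    let i , j , eq = hits (B (fromℕ< k<σ)) (subst (λ k → S k v) (sym (Fin.toℕ-fromℕ< k<σ)) s) in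
    fromℕ< k<σ ↑ˡ c , i , j ,
    trans (cong (λ X → ∣ X i j ∣) (lookup-++ˡ (λ k → entry (B k)) (λ k → entry (B′ k)) (fromℕ< k<σ))) eq
  locate {v} (inj₂ (k , k<c , s)) =
    let i , j , eq = hits (B′ (fromℕ< k<c)) (subst (λ k → S′ k v) (sym (Fin.toℕ-fromℕ< k<c)) s) in
    σ ↑ʳ fromℕ< k<c , i , j ,
    trans (cong (λ X → ∣ X i j ∣) (lookup-++ʳ (λ k → entry (B k)) (λ k → entry (B′ k)) (fromℕ< k<c))) eq
  onto : ∀ v → 1 ≤ v → v ≤ m * n * (σ + c) → ∃ λ k → ∃₂ λ i j → ∣ A k i j ∣ ≡ v
  onto (suc u) _ u<N = locate (everywhere u<N)

-- Distributing the numbers among all arrays.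

progression-blocks : ∀ D s c ℓ {v} → Progression D s (c * ℓ) v →
                     ∃ λ k → k < c × Progression (D + k * (ℓ * s)) s ℓ v
progression-blocks D s c ℓ (x , x<c*ℓ , refl) with digits c ℓ x<c*ℓ
... | k , i , k<c , i<ℓ , refl = k , k<c , i , i<ℓ , regroup D i k ℓ s
  where
  regroup : ∀ D i k ℓ s → D + (i + k * ℓ) * s ≡ D + k * (ℓ * s) + i * s
  regroup = solve-∀

over-two : ∀ {P : ℕ → ℕ → Set} σ w c w′ {v} → Over P 0 (σ * w + c * w′) v →
           (∃ λ k → k < σ × Over P (k * w) w v) ⊎ (∃ λ k → k < c × Over P (σ * w + k * w′) w′ v)
over-two σ w c w′ o = Sum.map (over-blocks 0 σ w) (over-blocks (σ * w) c w′) (over-split 0 (σ * w) o)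

splice : ℕ → (ℕ → ℕ) → (ℕ → ℕ) → ℕ → ℕ
splice zero    f g j       = g j
splice (suc q) f g zero    = f 0
splice (suc q) f g (suc j) = splice q (f ∘ suc) g j

splice-< : ∀ {q} f g {j} → j < q → splice q f g j ≡ f j
splice-< {suc q} f g {zero}  _         = refl
splice-< {suc q} f g {suc j} (s≤s j<q) = splice-< (f ∘ suc) g j<q

splice-+ : ∀ q f g j → splice q f g (q + j) ≡ g j
splice-+ zero    f g j = refl
splice-+ (suc q) f g j = splice-+ q (f ∘ suc) g j

-- Offsets of the bases of the quadruples that tile intervals of length 8.
pairs : ℕ → ℕ
pairs 0             = 0
pairs 1             = 1
pairs (suc (suc j)) = 8 + pairs j

pairs-value : ∀ a {e} → e < 2 → pairs (e + a * 2) ≡ e + a * 8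
pairs-value zero    {0} _ = refl
pairs-value zero    {1} _ = refl
pairs-value zero    {suc (suc _)} (s≤s (s≤s ()))
pairs-value (suc a) {e} e<2 = begin
  pairs (e + (2 + a * 2))   ≡⟨ cong pairs (shift e (a * 2) 2) ⟩
  8 + pairs (e + a * 2)     ≡⟨ cong (_+_ 8) (pairs-value a e<2) ⟩
  8 + (e + a * 8)           ≡⟨ shift e (a * 8) 8 ⟨
  e + (8 + a * 8)           ∎
  where
  open ≡-Reasoning
  shift : ∀ e x y → e + (y + x) ≡ y + (e + x)
  shift = solve-∀

module Layout {p q} (P : Size p) (Q : Size q) (a b : ℕ) where
  open Shape P Q a b

  d hs hr : ℕ
  d  = runQuads P Q
  hs = Corner.quota (special P Q) + rest
  hr = Corner.quota (regular P Q) + rest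

  cell-count : ∀ {s d} (K : Corner p q s d) → m₀ * n₀ ≡ 3 * width + (d + (Corner.quota K + rest)) * 4
  cell-count {_} {d} K = begin
    m₀ * n₀                                        ≡⟨ expand a b p q ⟩
    3 * width + p * q + rest * 4                   ≡⟨ cong (λ z → 3 * width + z + rest * 4) (Corner.area K) ⟨
    3 * width + (d + quota) * 4 + rest * 4         ≡⟨ collect (3 * width) d quota rest ⟩
    3 * width + (d + (quota + rest)) * 4           ∎
    where
    open ≡-Reasoning
    quota = Corner.quota K
    expand : ∀ a b p q → (3 + (a * 4 + p)) * (3 + (b * 4 + q)) ≡
             3 * (3 + q + b * 4 + (p + a * 4)) + p * q + (b * p + a * (q + b * 4)) * 4
    expand = solve-∀
    collect : ∀ z d x y → z + (d + x) * 4 + y * 4 ≡ z + (d + (x + y)) * 4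
    collect = solve-∀

  -- By `columns` the x are the first `4 * q₀ + r` odd numbers, where `q₀ = c * d + q′`. As `r ≤ 1`,
  -- they are all the odd numbers up to `8 * q₀ + r`, and `4 * q₀` even ones lie between them.
  -- `balance` equates the quadruples drawn by the arrays with the `q′` made of even numbers plus
  -- two for each of `y` intervals of length 8.
  module _ (σ c q′ r y : ℕ) (r≤1 : r ≤ 1)
           (columns : (σ + c) * width ≡ (c * d + q′) * 4 + r)
           (balance : σ * hs + c * hr ≡ q′ + y * 2) where

    -- The x and the quadruples of even numbers end at smalls, the intervals of
    -- length 12 at F, those of length 8 at G, the y at C and the z at C + M.
    M q₀ smalls F G C : ℕ
    M = (σ + c) * width
    q₀ = c * d + q′
    smalls = q₀ * 8 + r
    F = smalls + σ * 12
    G = F + y * 8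
    C = G + M

    -- The progressions of the `c` regular arrays take the first `c * (d * 4)` even numbers. Each
    -- quadruple after them uses four even numbers, so these bases advance by 8.
    base : ℕ → ℕ
    base = splice q′ (λ j → 2 + c * (d * 4) * 2 + j * 8) (λ j → suc F + pairs j)

    Special Regular : ℕ → ℕ → Set
    Special k = Cells C 3 1 hs (suc smalls + k * 12) base (k * width) (k * hs)
    Regular k = Cells C d 2 hr (2 + k * (d * 4 * 2)) base (σ * width + k * width) (σ * hs + k * hr)

    Anywhere : ℕ → Set
    Anywhere v = (∃ λ k → k < σ × Special k v) ⊎ (∃ λ k → k < c × Regular k v)

    inTriples : ∀ {v t} → t < M → Triple C t v → Anywhere v
    inTriples {v} {t} t<M tr =
      Sum.map (λ (k , k<σ , o) → k , k<σ , inj₁ o) (λ (k , k<c , o) → k , k<c , inj₁ o)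
        (over-two σ width c width (at t (subst (t <_) (*-distribʳ-+ width σ c) t<M) tr))

    inQuads : ∀ {v j} → j < q′ + y * 2 → Quad base j v → Anywhere v
    inQuads {v} {j} j<h qd =
      Sum.map (λ (k , k<σ , o) → k , k<σ , inj₂ (inj₂ o)) (λ (k , k<c , o) → k , k<c , inj₂ (inj₂ o))
        (over-two σ hs c hr (at j (subst (j <_) (sym balance) j<h) qd))

    small : ∀ {u} → u < smalls → Anywhere (suc u)
    small {u} u<s with u % 2 | u / 2 | m≡m%n+[m/n]*n u 2 | m%n<n u 2
    -- The value is `suc u`: an even `u` means an odd value, hence an x.
    ... | 0 | h | refl | _ = inTriples h<M (inj₁ (cong suc (*-comm h 2)))
      where
      h<M : h < M
      h<M = *-cancelʳ-< 2 h M (begin-strict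
        h * 2               <⟨ u<s ⟩
        q₀ * 8 + r          ≤⟨ m≤m+n _ r ⟩
        q₀ * 8 + r + r      ≡⟨ double q₀ r ⟩
        (q₀ * 4 + r) * 2    ≡⟨ cong (_* 2) columns ⟨
        M * 2               ∎)
        where
        open ≤-Reasoning
        double : ∀ q r → q * 8 + r + r ≡ (q * 4 + r) * 2
        double = solve-∀
    ... | 1 | h | refl | _ = even (split< (c * (d * 4)) h<)
      where
      h< : h < c * (d * 4) + q′ * 4
      h< = *-cancelʳ-< 2 h _ (s≤s⁻¹ (begin-strict
        1 + h * 2                             <⟨ u<s ⟩
        -- If `r` is 1, the range ends with one more odd number and contains no further even one.
        q₀ * 8 + r                            ≤⟨ +-monoʳ-≤ (q₀ * 8) r≤1 ⟩
        q₀ * 8 + 1                            ≡⟨ halve c d q′ ⟩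
        suc ((c * (d * 4) + q′ * 4) * 2)      ∎))
        where
        open ≤-Reasoning
        halve : ∀ c d q → (c * d + q) * 8 + 1 ≡ suc ((c * (d * 4) + q * 4) * 2)
        halve = solve-∀
      even : h < c * (d * 4) ⊎ (∃ λ x → x < q′ * 4 × h ≡ c * (d * 4) + x) → Anywhere (2 + h * 2)
      even (inj₁ h<4cd) with progression-blocks 2 2 c (d * 4) (h , h<4cd , refl)
      ... | k , k<c , pr = inj₂ (k , k<c , inj₂ (inj₁ pr))
      even (inj₂ (x , x<4q , refl)) with digits q′ 4 x<4q
      ... | j , i , j<q , i<4 , refl = inQuads (≤-trans j<q (m≤m+n q′ _))
        (i , i<4 , trans (regroup (c * (d * 4)) i j) (cong (_+ i * 2) (sym (splice-< _ _ j<q))))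
        where
        regroup : ∀ z i j → 2 + (z + (i + j * 4)) * 2 ≡ 2 + z * 2 + j * 8 + i * 2
        regroup = solve-∀
    ... | suc (suc _) | _ | _ | s≤s (s≤s ())

    aboveF : ∀ {x} → x < y * 8 → Anywhere (suc (F + x))
    aboveF x<8y with digits y 8 x<8y
    -- The parity `e` of the position in the interval of length 8 selects the quadruple, and half
    -- the position, `l`, selects its term.
    ... | a′ , z , a′<y , z<8 , refl with digits 4 2 z<8
    ... | l , e , l<4 , e<2 , refl =
      inQuads (+-monoʳ-< q′ index<) (l , l<4 , trans (regroup F e l a′) (cong (_+ l * 2) (sym base-eq)))
      where
      base-eq : base (q′ + (e + a′ * 2)) ≡ suc F + (e + a′ * 8)
      base-eq = trans (splice-+ q′ _ _ (e + a′ * 2)) (cong (_+_ (suc F)) (pairs-value a′ e<2))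
      index< : e + a′ * 2 < y * 2
      index< = ≤-trans (+-monoˡ-< (a′ * 2) e<2) (*-monoˡ-≤ 2 a′<y)
      regroup : ∀ F e l a → suc (F + (e + l * 2 + a * 8)) ≡ suc F + (e + a * 8) + l * 2
      regroup = solve-∀

    everywhere : ∀ {u} → u < C + M → Anywhere (suc u)
    everywhere u< with split< C u<
    ... | inj₂ (t , t<M , refl) = inTriples t<M (inj₂ (inj₂ refl))
    ... | inj₁ u<C with split< G u<C
    ... | inj₂ (s , s<M , refl) = inTriples t<M (inj₂ (inj₁ sum-eq))
      where
      -- The y decrease as `t` grows, so the range is read backwards.
      t = M ∸ suc s
      s+t≡M : suc s + t ≡ M
      s+t≡M = m+[n∸m]≡n s<M
      t<M : t < M
      t<M = subst (t <_) s+t≡M (s≤s (m≤n+m t s))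
      sum-eq : suc (G + s) + t ≡ C
      sum-eq = trans (regroup G s t) (cong (_+_ G) s+t≡M)
        where
        regroup : ∀ G s t → suc (G + s) + t ≡ G + (suc s + t)
        regroup = solve-∀
    ... | inj₁ u<G with split< F u<G
    ... | inj₂ (x , x<8y , refl) = aboveF x<8y
    ... | inj₁ u<F with split< smalls u<F
    ... | inj₁ u<s = small u<s
    ... | inj₂ (i , i<12σ , refl)
      with k , k<σ , pr ← progression-blocks (suc smalls) 1 σ 12 (i , i<12σ , cong (_+_ (suc smalls)) (sym (*-identityʳ i)))
      = inj₁ (k , k<σ , inj₂ (inj₁ pr))

    -- The triples contribute three times `M`. By `columns` the first `M` equals `4 * q₀ + r` and
    -- joins the `4 * q₀` even numbers to give `smalls`; the other two are the ranges of the y and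
    -- of the z.
    total : m₀ * n₀ * (σ + c) ≡ C + M
    total = begin
      m₀ * n₀ * (σ + c)                                                ≡⟨ *-distribˡ-+ (m₀ * n₀) σ c ⟩
      m₀ * n₀ * σ + m₀ * n₀ * c                                        ≡⟨ cong₂ (λ x y → x * σ + y * c) (cell-count (special P Q)) (cell-count (regular P Q)) ⟩
      (3 * width + (3 + hs) * 4) * σ + (3 * width + (d + hr) * 4) * c  ≡⟨ collect σ c width hs hr d ⟩
      M + (σ * hs + c * hr) * 4 + σ * 12 + c * d * 4 + M + M           ≡⟨ cong₂ (λ x y → x + y * 4 + σ * 12 + c * d * 4 + M + M) columns balance ⟩
      q₀ * 4 + r + (q′ + y * 2) * 4 + σ * 12 + c * d * 4 + M + M       ≡⟨ rearrange (c * d) q′ r y σ M ⟩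
      C + M                                                            ∎
      where
      open ≡-Reasoning
      collect : ∀ σ c w s r d → (3 * w + (3 + s) * 4) * σ + (3 * w + (d + r) * 4) * c ≡
                (σ + c) * w + (σ * s + c * r) * 4 + σ * 12 + c * d * 4 + (σ + c) * w + (σ + c) * w
      collect = solve-∀
      rearrange : ∀ z q r y σ M → (z + q) * 4 + r + (q + y * 2) * 4 + σ * 12 + z * 4 + M + M ≡
                  (z + q) * 8 + r + σ * 12 + y * 8 + M + M
      rearrange = solve-∀

    specialArray : ∀ k → k < σ → Filled m₀ n₀ (Special k)
    specialArray k k<σ = array (special P Q) C (suc smalls + k * 12) base (k * width) (k * hs) (begin
      k * width + width    ≡⟨ +-comm (k * width) width ⟩
      suc k * width        ≤⟨ *-monoˡ-≤ width (≤-trans k<σ (m≤m+n σ c)) ⟩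
      M                    ≤⟨ m≤n+m M G ⟩
      C                    ∎)
      where open ≤-Reasoning

    regularArray : ∀ k → k < c → Filled m₀ n₀ (Regular k)
    regularArray k k<c = array (regular P Q) C (2 + k * (d * 4 * 2)) base (σ * width + k * width) (σ * hs + k * hr) (begin
      σ * width + k * width + width   ≡⟨ regroup σ k width ⟩
      (σ + suc k) * width             ≤⟨ *-monoˡ-≤ width (+-monoʳ-≤ σ k<c) ⟩
      M                               ≤⟨ m≤n+m M G ⟩
      C                               ∎)
      where
      open ≤-Reasoning
      regroup : ∀ σ k w → σ * w + k * w + w ≡ (σ + suc k) * w
      regroup = solve-∀

    arraySet : ∃ λ (A : Vector (Array m₀ n₀) (σ + c)) → IsIHS m₀ n₀ (σ + c) A
    arraySet = assembleIHS specialArray regularArray (λ {u} u< → everywhere (subst (u <_) total u<))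

-- Choosing the numbers of special arrays and of quadruples.

record Split (W d hs hr c : ℕ) : Set where
  constructor split
  field
    {specials regulars evens r octets} : ℕ
    r≤1     : r ≤ 1
    count   : specials + regulars ≡ c
    columns : c * W ≡ (regulars * d + evens) * 4 + r
    balance : specials * hs + regulars * hr ≡ evens + octets * 2

-- Modulo 4, the multiples `3 * r` for `r` = 0, 1, 2, 3 are 0, 3, 2, 1. Thus the congruence on mnc
-- says that the number of triples is 0 or 1 modulo 4.
residue : ∀ r k → r < 4 → (3 * r + k * 4) % 4 ≡ 0 ⊎ (3 * r + k * 4) % 4 ≡ 3 → r ≤ 1
residue r k r<4 h = small r r<4 (subst (λ z → z ≡ 0 ⊎ z ≡ 3) ([m+kn]%n≡m%n (3 * r) k 4) h)
  where
  small : ∀ r → r < 4 → (3 * r) % 4 ≡ 0 ⊎ (3 * r) % 4 ≡ 3 → r ≤ 1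
  small 0 _ _ = z≤n
  small 1 _ _ = s≤s z≤n
  small 2 _ (inj₁ ())
  small 2 _ (inj₂ ())
  small 3 _ (inj₁ ())
  small 3 _ (inj₂ ())
  small (suc (suc (suc (suc _)))) (s≤s (s≤s (s≤s (s≤s ())))) _

halve : ∀ x → ∃ λ y → x ≡ y * 2 ⊎ x ≡ 1 + y * 2
halve x with x % 2 | x / 2 | m≡m%n+[m/n]*n x 2 | m%n<n x 2
... | 0 | y | x≡ | _ = y , inj₁ x≡
... | 1 | y | x≡ | _ = y , inj₂ x≡
... | suc (suc _) | _ | _ | s≤s (s≤s ())

-- The number c * (d + hr) ∸ q of quadruples not taken from the even numbers
-- below 8q decides by its parity whether a special array is needed.
splitting : ∀ W d hs hr c q r → d + hr ≡ 3 + hs → d * 4 < W → W + 5 ≤ (d + hr) * 4 →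
            c ≥ 1 → c * W ≡ q * 4 + r → r ≤ 1 → Split W d hs hr c
splitting W d hs hr c@(suc c₁) q r H≡ 4d<W W+5≤4H _ columns r≤1 = byParity (halve x)
  where
  open ≤-Reasoning
  x = c * (d + hr) ∸ q
  cd≤q : c * d ≤ q
  -- The strict inequality `4d<W` gains `c ≥ 1`, which pays for the remainder `r`.
  cd≤q = *-cancelʳ-≤ (c * d) q 4 (s≤s⁻¹ (begin
    suc (c * d * 4)       ≤⟨ s≤s (m≤n+m (c * d * 4) c₁) ⟩
    c + c * d * 4         ≡⟨ factor c d ⟩
    c * suc (d * 4)       ≤⟨ *-monoʳ-≤ c 4d<W ⟩
    c * W                 ≡⟨ columns ⟩
    q * 4 + r             ≤⟨ +-monoʳ-≤ (q * 4) r≤1 ⟩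
    q * 4 + 1             ≡⟨ +-comm (q * 4) 1 ⟩
    suc (q * 4)           ∎))
    where
    factor : ∀ c d → c + c * d * 4 ≡ c * suc (d * 4)
    factor = solve-∀
  q+2≤cH : suc q < c * (d + hr)
  -- The slack of 5 in `W+5≤4H` gives `x ≥ 2`, so an odd `x` is at least 3, the number of groups
  -- that an interval of length 12 replaces.
  q+2≤cH = *-cancelʳ-< 4 (suc q) (c * (d + hr)) (begin-strict
    suc q * 4             <⟨ n<1+n (suc q * 4) ⟩
    5 + q * 4             ≤⟨ +-monoʳ-≤ 5 (m≤m+n (q * 4) r) ⟩
    5 + (q * 4 + r)       ≡⟨ cong (_+_ 5) columns ⟨
    5 + c * W             ≤⟨ +-monoˡ-≤ (c * W) (m≤m+n 5 (c₁ * 5)) ⟩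
    c * 5 + c * W         ≡⟨ factor c W ⟩
    c * (W + 5)           ≤⟨ *-monoʳ-≤ c W+5≤4H ⟩
    c * ((d + hr) * 4)    ≡⟨ *-assoc c (d + hr) 4 ⟨
    c * (d + hr) * 4      ∎)
    where
    factor : ∀ c W → c * 5 + c * W ≡ c * (W + 5)
    factor = solve-∀
  cH≡ : c * (d + hr) ≡ q + x
  cH≡ = sym (m+[n∸m]≡n (≤-trans (n≤1+n q) (<⇒≤ q+2≤cH)))
  2≤x : 2 ≤ x
  2≤x = +-cancelˡ-≤ q 2 x (begin
    q + 2           ≡⟨ +-comm q 2 ⟩
    2 + q           ≤⟨ q+2≤cH ⟩
    c * (d + hr)    ≡⟨ cH≡ ⟩
    q + x           ∎)
  q≡ : ∀ {z} → z ≤ q → z + (q ∸ z) ≡ q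
  q≡ z≤q = m+[n∸m]≡n z≤q
  byParity : (∃ λ y → x ≡ y * 2 ⊎ x ≡ 1 + y * 2) → Split W d hs hr c
  byParity (y , inj₁ x≡2y) = record
    { specials = 0 ; regulars = c ; evens = q ∸ c * d ; octets = y
    ; r≤1 = r≤1
    ; count = refl
    ; columns = trans columns (cong (λ z → z * 4 + r) (sym (q≡ cd≤q)))
    ; balance = +-cancelˡ-≡ (c * d) _ _ (begin-equality
        c * d + c * hr                ≡⟨ *-distribˡ-+ c d hr ⟨
        c * (d + hr)                  ≡⟨ cH≡ ⟩
        q + x                         ≡⟨ cong₂ _+_ (sym (q≡ cd≤q)) x≡2y ⟩
        c * d + (q ∸ c * d) + y * 2   ≡⟨ +-assoc (c * d) _ _ ⟩
        c * d + (q ∸ c * d + y * 2)   ∎)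
    }
  byParity (zero , inj₂ x≡1) = contradiction (subst (2 ≤_) x≡1 2≤x) λ { (s≤s ()) }
  -- One special array trades three of the `x` quadruples for the interval, leaving an even number.
  -- Its corner has no progression of even numbers, so only `c₁ * d` groups are deducted from `q`.
  byParity (suc y , inj₂ x≡3+2y) = record
    { specials = 1 ; regulars = c₁ ; evens = q ∸ c₁ * d ; octets = y
    ; r≤1 = r≤1
    ; count = refl
    ; columns = trans columns (cong (λ z → z * 4 + r) (sym (q≡ c₁d≤q)))
    ; balance = +-cancelˡ-≡ (3 + c₁ * d) _ _ (begin-equality
        3 + c₁ * d + (1 * hs + c₁ * hr)      ≡⟨ regroup c₁ d hs hr ⟩
        3 + hs + c₁ * (d + hr)               ≡⟨ cong (_+ c₁ * (d + hr)) H≡ ⟨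
        c * (d + hr)                         ≡⟨ cH≡ ⟩
        q + x                                ≡⟨ cong₂ _+_ (sym (q≡ c₁d≤q)) x≡3+2y ⟩
        c₁ * d + (q ∸ c₁ * d) + (3 + y * 2)  ≡⟨ collect (c₁ * d) (q ∸ c₁ * d) (y * 2) ⟩
        3 + c₁ * d + (q ∸ c₁ * d + y * 2)    ∎)
    }
    where
    c₁d≤q : c₁ * d ≤ q
    c₁d≤q = ≤-trans (m≤n+m (c₁ * d) d) cd≤q
    regroup : ∀ c d s r → 3 + c * d + (1 * s + c * r) ≡ 3 + s + c * (d + r)
    regroup = solve-∀
    collect : ∀ z e y → z + e + (3 + y) ≡ 3 + z + (e + y)
    collect = solve-∀

-- Size estimates and the theorem.

module Existence {p q} (P : Size p) (Q : Size q) (a b : ℕ) where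
  open Shape P Q a b
  open Layout P Q a b

  4≤size : ∀ {p} → Size p → 4 ≤ p
  4≤size four = ≤-refl
  4≤size six  = m≤m+n 4 2

  run<width : d * 4 < width
  run<width = s≤s (begin
    d * 4                                    ≤⟨ run≤ P Q ⟩
    p + q                                    ≤⟨ m≤m+n (p + q) (2 + b * 4 + a * 4) ⟩
    p + q + (2 + b * 4 + a * 4)              ≡⟨ regroup a b p q ⟩
    2 + q + b * 4 + (p + a * 4)              ∎)
    where
    open ≤-Reasoning
    regroup : ∀ a b p q → p + q + (2 + b * 4 + a * 4) ≡ 2 + q + b * 4 + (p + a * 4)
    regroup = solve-∀
    run≤ : ∀ {p q} (P : Size p) (Q : Size q) → runQuads P Q * 4 ≤ p + q
    run≤ four four = z≤n
    run≤ four six  = z≤n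
    run≤ six  four = z≤n
    run≤ six  six  = ≤-refl

  inner-area : (d + hr) * 4 ≡ (a * 4 + p) * (b * 4 + q)
  inner-area = +-cancelˡ-≡ (3 * width) _ _ (trans (sym (cell-count (regular P Q))) (expand a b p q))
    where
    expand : ∀ a b p q → (3 + (a * 4 + p)) * (3 + (b * 4 + q)) ≡
             3 * (3 + q + b * 4 + (p + a * 4)) + (a * 4 + p) * (b * 4 + q)
    expand = solve-∀

  -- The inner part has sides `u` and `v` of at least 4, whence `u * v ≥ u + v + 8`, with equality
  -- for 4 × 4; here `u + v + 3` is the width.
  width≤area : width + 5 ≤ (d + hr) * 4
  width≤area = begin
    width + 5                                        ≡⟨ regroup a b p q ⟩
    u + v + 8                                        ≡⟨ cong₂ (λ x y → x + y + 8) u≡ v≡ ⟨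
    4 + x + (4 + y) + 8                              ≤⟨ m≤m+n _ (3 * x + 3 * y + x * y) ⟩
    4 + x + (4 + y) + 8 + (3 * x + 3 * y + x * y)    ≡⟨ expand x y ⟩
    (4 + x) * (4 + y)                                ≡⟨ cong₂ _*_ u≡ v≡ ⟩
    u * v                                            ≡⟨ inner-area ⟨
    (d + hr) * 4                                     ∎
    where
    open ≤-Reasoning
    u = a * 4 + p
    v = b * 4 + q
    x = u ∸ 4
    y = v ∸ 4
    u≡ : 4 + x ≡ u
    u≡ = m+[n∸m]≡n (≤-trans (4≤size P) (m≤n+m p (a * 4)))
    v≡ : 4 + y ≡ v
    v≡ = m+[n∸m]≡n (≤-trans (4≤size Q) (m≤n+m q (b * 4)))
    regroup : ∀ a b p q → 3 + q + b * 4 + (p + a * 4) + 5 ≡ a * 4 + p + (b * 4 + q) + 8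
    regroup = solve-∀
    expand : ∀ x y → 4 + x + (4 + y) + 8 + (3 * x + 3 * y + x * y) ≡ (4 + x) * (4 + y)
    expand = solve-∀

  -- Both corners fill the same area, so comparing the two cell counts suffices.
  quota-balance : d + hr ≡ 3 + hs
  quota-balance = *-cancelʳ-≡ _ _ 4 (+-cancelˡ-≡ (3 * width) _ _
    (trans (sym (cell-count (regular P Q))) (cell-count (special P Q))))

  exists : ∀ c → c ≥ 1 → (m₀ * n₀ * c) % 4 ≡ 0 ⊎ (m₀ * n₀ * c) % 4 ≡ 3 →
           ∃ λ (A : Vector (Array m₀ n₀) c) → IsIHS m₀ n₀ c A
  exists c c≥1 N%4 = fromSplit (splitting width d hs hr c (c * width / 4) (c * width % 4)
      quota-balance run<width width≤area c≥1 cW≡ r≤1)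
    where
    cW≡ : c * width ≡ c * width / 4 * 4 + c * width % 4
    cW≡ = trans (m≡m%n+[m/n]*n (c * width) 4) (+-comm (c * width % 4) _)
    N≡ : m₀ * n₀ * c ≡ 3 * (c * width % 4) + (3 * (c * width / 4) + (d + hr) * c) * 4
    N≡ = begin
      m₀ * n₀ * c                                              ≡⟨ cong (_* c) (cell-count (regular P Q)) ⟩
      (3 * width + (d + hr) * 4) * c                           ≡⟨ regroup width (d + hr) c ⟩
      3 * (c * width) + (d + hr) * c * 4                       ≡⟨ cong (λ z → 3 * z + (d + hr) * c * 4) (m≡m%n+[m/n]*n (c * width) 4) ⟩
      3 * (c * width % 4 + c * width / 4 * 4) + (d + hr) * c * 4   ≡⟨ collect (c * width % 4) (c * width / 4) ((d + hr) * c) ⟩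
      3 * (c * width % 4) + (3 * (c * width / 4) + (d + hr) * c) * 4  ∎
      where
      open ≡-Reasoning
      regroup : ∀ w h c → (3 * w + h * 4) * c ≡ 3 * (c * w) + h * c * 4
      regroup = solve-∀
      collect : ∀ r q z → 3 * (r + q * 4) + z * 4 ≡ 3 * r + (3 * q + z) * 4
      collect = solve-∀
    r≤1 : c * width % 4 ≤ 1
    r≤1 = residue (c * width % 4) (3 * (c * width / 4) + (d + hr) * c) (m%n<n (c * width) 4)
      (subst (λ N → N % 4 ≡ 0 ⊎ N % 4 ≡ 3) N≡ N%4)
    fromSplit : ∀ {c} → Split width d hs hr c → ∃ λ (A : Vector (Array m₀ n₀) c) → IsIHS m₀ n₀ c A
    fromSplit (split {σ} {c} {q′} {r} {y} r≤1 refl columns balance) = arraySet σ c q′ r y r≤1 columns balance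

-- The residue of `m - 7` modulo 4 decides: 0 gives side 4, 2 gives side 6, and 1 or 3 would make
-- `m` even.
odd≥7 : ∀ m → m ≥ 7 → Odd m → ∃ λ a → ∃ λ p → Size p × m ≡ 3 + (a * 4 + p)
odd≥7 m m≥7 odd = cases ((m ∸ 7) % 4) ((m ∸ 7) / 4) (m%n<n (m ∸ 7) 4)
  (trans (sym (m+[n∸m]≡n m≥7)) (cong (_+_ 7) (m≡m%n+[m/n]*n (m ∸ 7) 4)))
  where
  not-even : ∀ k → m ≢ k * 2
  not-even k m≡2k = contradiction (trans (sym odd) (trans (cong (_% 2) m≡2k) (m*n%n≡0 k 2))) λ ()
  remainder-0 : ∀ a → 7 + (0 + a * 4) ≡ 3 + (a * 4 + 4)
  remainder-0 = solve-∀
  remainder-1 : ∀ a → 7 + (1 + a * 4) ≡ (4 + a * 2) * 2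
  remainder-1 = solve-∀
  remainder-2 : ∀ a → 7 + (2 + a * 4) ≡ 3 + (a * 4 + 6)
  remainder-2 = solve-∀
  remainder-3 : ∀ a → 7 + (3 + a * 4) ≡ (5 + a * 2) * 2
  remainder-3 = solve-∀
  cases : ∀ r a → r < 4 → m ≡ 7 + (r + a * 4) → ∃ λ a → ∃ λ p → Size p × m ≡ 3 + (a * 4 + p)
  cases 0 a _ m≡ = a , 4 , four , trans m≡ (remainder-0 a)
  cases 1 a _ m≡ = contradiction (trans m≡ (remainder-1 a)) (not-even (4 + a * 2))
  cases 2 a _ m≡ = a , 6 , six , trans m≡ (remainder-2 a)
  cases 3 a _ m≡ = contradiction (trans m≡ (remainder-3 a)) (not-even (5 + a * 2))
  cases (suc (suc (suc (suc _)))) _ (s≤s (s≤s (s≤s (s≤s ())))) _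

theorem1p4 : (m n c : ℕ) → m ≥ 1 → n ≥ 1 → c ≥ 1 →
    ((m * n * c) % 4 ≡ 0 ⊎ (m * n * c) % 4 ≡ 3) →
    m ≥ 7 → n ≥ 7 → Odd m → Odd n →
    ∃ λ (A : Vector (Array m n) c) → IsIHS m n c A
theorem1p4 m n c _ _ c≥1 N%4 m≥7 n≥7 m-odd n-odd
  with a , p , P , refl ← odd≥7 m m≥7 m-odd
  with b , q , Q , refl ← odd≥7 n n≥7 n-odd
  = Existence.exists P Q a b c c≥1 N%4
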